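{- $\gamma^+(J_4) = \frac{4}{7}$, where $J_4$ is the $3$-graph on vertex set $\{1,2,3,4,5\}$ with edges $\{1ij : 2\leq i<j\leq 5\}$.
   Context: For a $3$-graph $H$, the minimum positive co-degree $\delta_2^+(H)$ is the largest $k$ such that every pair of vertices contained in some edge of $H$ is contained in at least $k$ edges (it is $0$ for the edgeless graph). For a $3$-graph $F$, $\mathrm{co^+ex}(n,F)$ is the maximum of $\delta_2^+(H)$ over $n$-vertex $3$-graphs $H$ not containing $F$ as a (not necessarily induced) subhypergraph, and $\gamma^+(F)=\lim_{n\to\infty}\mathrm{co^+ex}(n,F)/n$ (the limit exists). -}

module Defs where

open import Data.Bool using (Bool; true; false; if_then_else_; _∧_; _∨_; not)
open import Data.Nat using (ℕ; zero; suc; _≤_; _⊓_; _≤ᵇ_)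
open import Data.Fin using (Fin; zero; suc; _≟_)
open import Data.Fin.Properties using (all?)
open import Data.Nat.ListAction using (sum)
open import Data.List using (List; []; _∷_; map; allFin; concatMap; filterᵇ; foldr)
open import Data.Product using (Σ; _×_)
open import Data.Bool.Properties using () renaming (_≟_ to _≟ᵇ_)
open import Relation.Nullary using (¬_; does)
open import Relation.Nullary.Decidable using (toWitness)
open import Relation.Binary.PropositionalEquality using (_≡_; refl)
open import Function.Definitions using (Injective)

record ThreeGraph (n : ℕ) : Set where
  field
    edge  : Fin n → Fin n → Fin n → Bool
    sym₁₂ : ∀ a b c → edge a b c ≡ edge b a c
    sym₂₃ : ∀ a b c → edge a b c ≡ edge a c b
    irr   : ∀ a c → edge a a c ≡ false
open ThreeGraph public

codeg : ∀ {n} → ThreeGraph n → Fin n → Fin n → ℕ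
codeg {n} H x y = sum (map (λ z → if edge H x y z then 1 else 0) (allFin n))

minList : List ℕ → ℕ
minList []       = 0
minList (x ∷ xs) = foldr _⊓_ x xs

-- minimum positive co-degree: minimum of the co-degrees over all pairs
-- contained in some edge (i.e. with positive co-degree); 0 if H has no edges.
δ₂⁺ : ∀ {n} → ThreeGraph n → ℕ
δ₂⁺ {n} H =
  minList (filterᵇ (λ k → 1 ≤ᵇ k)
    (concatMap (λ x → map (λ y → codeg H x y) (allFin n)) (allFin n)))

Contains : ∀ {k n} → ThreeGraph n → ThreeGraph k → Set
Contains {k} {n} H F =
  Σ (Fin k → Fin n) λ f → Injective _≡_ _≡_ f ×
    (∀ a b c → edge F a b c ≡ true → edge H (f a) (f b) (f c) ≡ true)

_-free : ∀ {k n} → ThreeGraph k → ThreeGraph n → Set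
(F -free) H = ¬ Contains H F

-- J₄ on {1,…,5} (here Fin 5, vertex 1 ↦ zero): edges {1,i,j}, 2 ≤ i < j ≤ 5,
-- i.e. all triples of distinct vertices containing vertex 1.
private
  eqᵇ : Fin 5 → Fin 5 → Bool
  eqᵇ a b = does (a ≟ b)

  isOne : Fin 5 → Bool
  isOne zero    = true
  isOne (suc _) = false

  J₄edge : Fin 5 → Fin 5 → Fin 5 → Bool
  J₄edge a b c = not (eqᵇ a b) ∧ not (eqᵇ b c) ∧ not (eqᵇ a c)
                 ∧ (isOne a ∨ isOne b ∨ isOne c)

J₄ : ThreeGraph 5
J₄ = record
  { edge  = J₄edge
  ; sym₁₂ = λ a b c → toWitness {a? = all? λ a → all? λ b → all? λ c →
               J₄edge a b c ≟ᵇ J₄edge b a c} _ a b c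
  ; sym₂₃ = λ a b c → toWitness {a? = all? λ a → all? λ b → all? λ c →
               J₄edge a b c ≟ᵇ J₄edge a c b} _ a b c
  ; irr   = λ a c → toWitness {a? = all? λ a → all? λ c →
               J₄edge a a c ≟ᵇ false} _ a c
  }

{-# OPTIONS --safe #-}

-- Lower bound: blow up the complement of the Fano plane, i.e. split the vertices into seven nearly
-- equal parts indexed by the points and take the triples meeting three non-collinear points. Every
-- pair of distinct points has four points off its line, and the link of a vertex is a blow-up of
-- K₂,₂,₂, which has no K₄.
--
-- Upper bound: a J₄-free H satisfies 7 δ₂⁺(H) ≤ 4 n exactly. Suppose not. Put nonnegative weights of
-- total W on pairs of vertices of a configuration F found in H, each pair lying in a triple of F.
-- Averaging over the vertices u, some u completes pairs of weight more than 4W/7 to edges. If every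
-- such extension of F by a vertex contains a configuration already known not to map into H, then F
-- does not map into H either. Starting from J₄ this excludes successively
-- C₇, C₆, C₆′, C₅, K₄, D₆, D₅, K₄⁻ and finally a single edge, so H has no edges. The configurations,
-- weights and maps were found by computer search; each step is a finite check done by evaluation.
module Submission where

open import Defs
open import Data.Nat using (ℕ; _≤_)
open import Data.Integer using (+_)
open import Data.Rational using (ℚ; 0ℚ; _/_; _+_; _-_; _*_) renaming (_≤_ to _≤ℚ_; _<_ to _<ℚ_)
open import Data.Product using (Σ; ∃; _×_)

open import Data.Bool using (Bool; true; false; if_then_else_; _∧_; _∨_; _xor_; T)
open import Data.Bool.ListAction using (all; any)
open import Data.Bool.Properties using (T-∧; T-∨; ¬-not) renaming (_≟_ to _≟ᵇ_)
open import Data.Empty using (⊥)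
open import Data.Fin using (Fin; zero; suc; toℕ; #_) renaming (_≟_ to _≟ᶠ_)
open import Data.Fin.Properties using (any?; all?)
open import Data.List using (List; []; _∷_; map; filter; concatMap; upTo; allFin; length; tabulate)
open import Data.List.Membership.Propositional using (_∈_; find; lose)
open import Data.List.Membership.Propositional.Properties
  using (∈-map⁺; ∈-map⁻; ∈-concatMap⁺; ∈-concatMap⁻; ∈-filter⁺; ∈-filter⁻; ∈-allFin; foldr-selective)
open import Data.List.Properties using (map-tabulate; length-tabulate)
open import Data.List.Relation.Unary.All as All using (All; []; _∷_)
import Data.List.Relation.Unary.All.Properties as All
open import Data.List.Relation.Unary.Any as Any using (Any; here; there)
import Data.List.Relation.Unary.Any.Properties as Any
import Data.Integer as ℤ
import Data.Integer.Properties as ℤ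
import Data.Nat as ℕ
open import Data.Nat using (zero; suc; z≤n; s≤s; _≤ᵇ_; _⊓_)
import Data.Nat.Properties as ℕ
open import Data.Nat.ListAction using (sum)
open import Data.Nat.Tactic.RingSolver using (solve-∀)
open import Data.Product using (_,_; proj₁; proj₂; ∃-syntax)
open import Data.Product.Properties using (≡-dec)
import Data.Rational as ℚ
import Data.Rational.Properties as ℚ
import Data.Rational.Unnormalised as ℚᵘ
import Data.Rational.Unnormalised.Properties as ℚᵘ
import Data.Vec
open import Data.Sum using (_⊎_; inj₁; inj₂)
open import Function using (_∘_; id)
open import Function.Bundles using (Equivalence)
open import Relation.Binary.PropositionalEquality
open import Relation.Nullary using (¬_; Dec; yes; no; does; contradiction; ¬?; _→-dec_; _⊎-dec_)
open import Relation.Nullary.Decidable using (toWitness)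

-- Sums and indicator counts over lists.

module Summation {a} {A : Set a} where

  sum-map-+ : ∀ (g h : A → ℕ) xs →
    sum (map (λ x → g x ℕ.+ h x) xs) ≡ sum (map g xs) ℕ.+ sum (map h xs)
  sum-map-+ g h []       = refl
  sum-map-+ g h (x ∷ xs) rewrite sum-map-+ g h xs =
    interchange (g x) (h x) (sum (map g xs)) (sum (map h xs))
    where
    interchange : ∀ a b c d → (a ℕ.+ b) ℕ.+ (c ℕ.+ d) ≡ (a ℕ.+ c) ℕ.+ (b ℕ.+ d)
    interchange = solve-∀

  sum-map-if : ∀ w (e : A → Bool) xs →
    sum (map (λ x → if e x then w else 0) xs) ≡ w ℕ.* sum (map (λ x → if e x then 1 else 0) xs)
  sum-map-if w e []       = sym (ℕ.*-zeroʳ w)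
  sum-map-if w e (x ∷ xs) rewrite sum-map-if w e xs with e x
  ... | true  = sym (ℕ.*-suc w _)
  ... | false = refl

  sum-map-≤ : ∀ (g : A → ℕ) c xs → (∀ x → g x ≤ c) → sum (map g xs) ≤ length xs ℕ.* c
  sum-map-≤ g c []       g≤c = z≤n
  sum-map-≤ g c (x ∷ xs) g≤c = ℕ.+-mono-≤ (g≤c x) (sum-map-≤ g c xs g≤c)

  sum-map-* : ∀ c (g : A → ℕ) xs → sum (map (λ x → c ℕ.* g x) xs) ≡ c ℕ.* sum (map g xs)
  sum-map-* c g []       = sym (ℕ.*-zeroʳ c)
  sum-map-* c g (x ∷ xs) rewrite sum-map-* c g xs = sym (ℕ.*-distribˡ-+ c (g x) _)

  indicator-sum-positive : ∀ (e : A → Bool) {x xs} → x ∈ xs → e x ≡ true →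
    1 ≤ sum (map (λ x → if e x then 1 else 0) xs)
  indicator-sum-positive e (here refl) ex rewrite ex = s≤s z≤n
  indicator-sum-positive e (there x∈xs) ex =
    ℕ.≤-trans (indicator-sum-positive e x∈xs ex) (ℕ.m≤n+m _ _)

  indicator-sum-witness : ∀ (e : A → Bool) xs →
    1 ≤ sum (map (λ x → if e x then 1 else 0) xs) → ∃[ x ] e x ≡ true
  indicator-sum-witness e (x ∷ xs) pos with e x in ex
  ... | true  = x , ex
  ... | false = indicator-sum-witness e xs pos

open Summation

-- The minimum positive co-degree in terms of edges.

minList-≤ : ∀ {x xs} → x ∈ xs → minList xs ≤ x
minList-≤ {xs = y ∷ ys} = foldr-⊓-≤ y ys
  where
  foldr-⊓-≤ : ∀ y ys {x} → x ∈ y ∷ ys → Data.List.foldr _⊓_ y ys ≤ x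
  foldr-⊓-≤ y []       (here refl)         = ℕ.≤-refl
  foldr-⊓-≤ y (z ∷ zs) (here refl)         = ℕ.≤-trans (ℕ.m⊓n≤n z _) (foldr-⊓-≤ y zs (here refl))
  foldr-⊓-≤ y (z ∷ zs) (there (here refl)) = ℕ.m⊓n≤m z _
  foldr-⊓-≤ y (z ∷ zs) (there (there x∈))  = ℕ.≤-trans (ℕ.m⊓n≤n z _) (foldr-⊓-≤ y zs (there x∈))

minList-∈ : ∀ x xs → minList (x ∷ xs) ∈ x ∷ xs
minList-∈ x xs with foldr-selective ℕ.⊓-sel x xs
... | inj₁ eq  = here eq
... | inj₂ m∈xs = there m∈xs

module CoDegree {n} (H : ThreeGraph n) where

  codegs : List ℕ
  codegs = concatMap (λ x → map (codeg H x) (allFin n)) (allFin n)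

  positive : List ℕ
  positive = Data.List.filterᵇ (1 ≤ᵇ_) codegs

  codeg∈positive : ∀ x y → 1 ≤ codeg H x y → codeg H x y ∈ positive
  codeg∈positive x y 1≤ =
    ∈-filter⁺ (Data.Bool.T? ∘ (1 ≤ᵇ_))
      (∈-concatMap⁺ (λ x → map (codeg H x) (allFin n))
        (lose (∈-allFin x) (∈-map⁺ (codeg H x) (∈-allFin y))))
      (ℕ.≤⇒≤ᵇ 1≤)

  positive⇒codeg : ∀ {k} → k ∈ positive → ∃[ x ] ∃[ y ] (k ≡ codeg H x y × 1 ≤ codeg H x y)
  positive⇒codeg {k} k∈ with ∈-filter⁻ (Data.Bool.T? ∘ (1 ≤ᵇ_)) {xs = codegs} k∈
  ... | k∈codegs , 1≤k with find (∈-concatMap⁻ (λ x → map (codeg H x) (allFin n)) {xs = allFin n} k∈codegs)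
  ...   | x , _ , k∈row with ∈-map⁻ (codeg H x) k∈row
  ...     | y , _ , refl = x , y , refl , ℕ.≤ᵇ⇒≤ 1 _ 1≤k

  edge⇒codeg-positive : ∀ {x y z} → edge H x y z ≡ true → 1 ≤ codeg H x y
  edge⇒codeg-positive {x} {y} {z} = indicator-sum-positive (edge H x y) (∈-allFin z)

  δ₂⁺≤codeg : ∀ {x y z} → edge H x y z ≡ true → δ₂⁺ H ≤ codeg H x y
  δ₂⁺≤codeg {x} {y} e = minList-≤ (codeg∈positive x y (edge⇒codeg-positive e))

  -- The edge makes `positive` nonempty, so the minimum is an actual co-degree and not the default 0
  -- of `minList`.
  δ₂⁺-attained : ∀ {x y z} → edge H x y z ≡ true →
    ∃[ x ] ∃[ y ] (δ₂⁺ H ≡ codeg H x y × 1 ≤ codeg H x y)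
  δ₂⁺-attained {x} {y} e with positive in eq | codeg∈positive x y (edge⇒codeg-positive e)
  ... | k ∷ ks | _ = positive⇒codeg (subst (minList (k ∷ ks) ∈_) (sym eq) (minList-∈ k ks))

  δ₂⁺>0⇒edge : 1 ≤ δ₂⁺ H → ∃[ x ] ∃[ y ] ∃[ z ] edge H x y z ≡ true
  δ₂⁺>0⇒edge 1≤δ with positive in eq | 1≤δ
  ... | k ∷ ks | _ with positive⇒codeg (subst (k ∈_) (sym eq) (here refl))
  ...   | x , y , _ , 1≤codeg with indicator-sum-witness (edge H x y) (allFin n) 1≤codeg
  ...     | z , e = x , y , z , e

-- Configurations, weightings and the finite check.

Triple : Set
Triple = ℕ × ℕ × ℕ

Config : Set
Config = List Triple

_≟ᵗ_ : (s t : Triple) → Dec (s ≡ t)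
_≟ᵗ_ = ≡-dec ℕ._≟_ (≡-dec ℕ._≟_ ℕ._≟_)

open import Data.List.Membership.DecPropositional _≟ᵗ_ using (_∈?_)

-- Configurations list their triples in increasing order; `sort` brings an image triple to this form
-- before a membership test.
swap₁₂ swap₂₃ sort shift : Triple → Triple
swap₁₂ (a , b , c) = if a ≤ᵇ b then (a , b , c) else (b , a , c)
swap₂₃ (a , b , c) = if b ≤ᵇ c then (a , b , c) else (a , c , b)
sort   t           = swap₁₂ (swap₂₃ (swap₁₂ t))
shift  (a , b , c) = suc a , suc b , suc c

-- A map of labels is stored as the list of its values. Labels past the end go to 0, which is
-- harmless: every map of labels yields a valid obstruction.
at : List ℕ → ℕ → ℕ
at []       _       = 0
at (x ∷ xs) zero    = x
at (x ∷ xs) (suc i) = at xs i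

image : List ℕ → Triple → Triple
image m (a , b , c) = at m a , at m b , at m c

-- The label 0 stands for the new vertex u and the vertices of F are shifted up by one. If F occurs
-- in H and D does not, one of these triples is a non-edge.
unknown : Config → Config → List ℕ → Config
unknown F D m = filter (λ t → ¬? (t ∈? map shift F)) (map (sort ∘ image m) D)

-- An entry (a , b , w) puts weight w on the pair {a , b}.
Weighting : Set
Weighting = List (ℕ × ℕ × ℕ)

total : Weighting → ℕ
total []                 = 0
total ((a , b , w) ∷ ws) = w ℕ.+ total ws

-- Triples from `unknown` are sorted, so a pair listed with `a` < `b` is recognised. Missing a pair
-- could only make `light` harder to satisfy.
lost : Config → Weighting → ℕ
lost M []                 = 0
lost M ((a , b , w) ∷ ws) = (if does ((0 , suc a , suc b) ∈? M) then w else 0) ℕ.+ lost M ws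

-- Then the pairs not in M carry weight at most 4/7 of the total.
light : Weighting → Config → Bool
light ws M = 3 ℕ.* total ws ≤ᵇ 7 ℕ.* lost M ws

-- Each obstruction contains a non-edge: branch over which triple it is, accumulating non-edges in M.
search : Weighting → List Config → Config → Bool
search ws []       M = light ws M
search ws (o ∷ os) M =
  light ws M ∨
  (if does (Any.any? (_∈? M) o) then search ws os M else all (λ t → search ws os (t ∷ M)) o)

obstructions : Config → List (Config × List (List ℕ)) → List Config
obstructions F = concatMap λ (D , ms) → map (unknown F D) ms

-- Guarantees that a weighted pair has co-degree at least `δ₂⁺`. The bound 7 is the number of labels
-- of `C₇`, the largest configuration.
covered : Config → ℕ × ℕ × ℕ → Bool
covered F (a , b , _) = any (λ c → does (sort (a , b , c) ∈? F)) (upTo 7)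

check : Config → Weighting → List (Config × List (List ℕ)) → Bool
check F ws Ds = (1 ≤ᵇ total ws) ∧ (all (covered F) ws ∧ search ws (obstructions F Ds) [])

_◃_ : ∀ {n} → Fin n → (ℕ → Fin n) → ℕ → Fin n
(u ◃ f) zero    = u
(u ◃ f) (suc i) = f i

-- Soundness of the check and the averaging argument.

module Configurations {n} (H : ThreeGraph n) where

  open CoDegree H

  holds : (ℕ → Fin n) → Triple → Bool
  holds f (a , b , c) = edge H (f a) (f b) (f c)

  -- The map f need not be injective: irreflexivity keeps the vertices of each triple apart.
  Realises : (ℕ → Fin n) → Config → Set
  Realises f F = All (λ t → holds f t ≡ true) F

  Forbidden : Config → Set
  Forbidden F = ∀ f → ¬ Realises f F

  holds-swap₁₂ : ∀ f t → holds f (swap₁₂ t) ≡ holds f t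
  holds-swap₁₂ f (a , b , c) with a ≤ᵇ b
  ... | true  = refl
  ... | false = sym₁₂ H _ _ _

  holds-swap₂₃ : ∀ f t → holds f (swap₂₃ t) ≡ holds f t
  holds-swap₂₃ f (a , b , c) with b ≤ᵇ c
  ... | true  = refl
  ... | false = sym₂₃ H _ _ _

  holds-sort : ∀ f t → holds f (sort t) ≡ holds f t
  holds-sort f t = trans (holds-swap₁₂ f _) (trans (holds-swap₂₃ f _) (holds-swap₁₂ f t))

  score : (ℕ → Fin n) → Fin n → Weighting → ℕ
  score f u []                 = 0
  score f u ((a , b , w) ∷ ws) = (if edge H (f a) (f b) u then w else 0) ℕ.+ score f u ws

  NonEdges : (ℕ → Fin n) → Config → Set
  NonEdges f M = All (λ t → holds f t ≡ false) M

  -- A pair counted in `lost` forms a non-edge with `u`, so its weight is absent from `score`.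
  score+lost≤total : ∀ f u {M} → NonEdges (u ◃ f) M → ∀ ws →
    score f u ws ℕ.+ lost M ws ≤ total ws
  score+lost≤total f u M∉H [] = z≤n
  score+lost≤total f u {M} M∉H ((a , b , w) ∷ ws) = begin
    (s ℕ.+ score f u ws) ℕ.+ (l ℕ.+ lost M ws) ≡⟨ interchange s _ l _ ⟩
    (s ℕ.+ l) ℕ.+ (score f u ws ℕ.+ lost M ws) ≤⟨ ℕ.+-mono-≤ s+l≤w (score+lost≤total f u M∉H ws) ⟩
    w ℕ.+ total ws                             ∎
    where
    open ℕ.≤-Reasoning
    interchange : ∀ a b c d → (a ℕ.+ b) ℕ.+ (c ℕ.+ d) ≡ (a ℕ.+ c) ℕ.+ (b ℕ.+ d)
    interchange = solve-∀
    s l : ℕ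
    s = if edge H (f a) (f b) u then w else 0
    l = if does ((0 , suc a , suc b) ∈? M) then w else 0
    s+l≤w : s ℕ.+ l ≤ w
    s+l≤w with (0 , suc a , suc b) ∈? M
    ... | yes t∈M rewrite trans (trans (sym₂₃ H _ _ _) (sym₁₂ H _ _ _)) (All.lookup M∉H t∈M) = ℕ.≤-refl
    ... | no  _ with edge H (f a) (f b) u
    ...   | true  = ℕ.≤-reflexive (ℕ.+-identityʳ w)
    ...   | false = z≤n

  light-sound : ∀ f u {M} → NonEdges (u ◃ f) M → ∀ ws → T (light ws M) →
    7 ℕ.* score f u ws ≤ 4 ℕ.* total ws
  light-sound f u {M} M∉H ws ok = ℕ.+-cancelʳ-≤ (7 ℕ.* lost M ws) _ _ (begin
    7 ℕ.* score f u ws ℕ.+ 7 ℕ.* lost M ws ≡⟨ ℕ.*-distribˡ-+ 7 (score f u ws) _ ⟨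
    7 ℕ.* (score f u ws ℕ.+ lost M ws)     ≤⟨ ℕ.*-monoʳ-≤ 7 (score+lost≤total f u M∉H ws) ⟩
    7 ℕ.* total ws                         ≡⟨ ℕ.*-distribʳ-+ (total ws) 4 3 ⟩
    4 ℕ.* total ws ℕ.+ 3 ℕ.* total ws      ≤⟨ ℕ.+-monoʳ-≤ (4 ℕ.* total ws) (ℕ.≤ᵇ⇒≤ _ _ ok) ⟩
    4 ℕ.* total ws ℕ.+ 7 ℕ.* lost M ws     ∎)
    where open ℕ.≤-Reasoning

  -- Follow the branch that selects, in each obstruction, a triple that really is a non-edge for
  -- this `u`. Along it `M` contains only true non-edges, so `light-sound` applies where it ends.
  search-sound : ∀ f u ws os {M} → NonEdges (u ◃ f) M →
    All (Any (λ t → holds (u ◃ f) t ≡ false)) os → T (search ws os M) →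
    7 ℕ.* score f u ws ≤ 4 ℕ.* total ws
  search-sound f u ws []       M∉H []           ok = light-sound f u M∉H ws ok
  search-sound f u ws (o ∷ os) {M} M∉H (hit ∷ hits) ok with Equivalence.to T-∨ ok
  ... | inj₁ ok′ = light-sound f u M∉H ws ok′
  ... | inj₂ ok′ with does (Any.any? (_∈? M) o)
  ...   | true  = search-sound f u ws os M∉H hits ok′
  ...   | false with find hit
  ...     | t , t∈o , t∉H =
    search-sound f u ws os (t∉H ∷ M∉H) hits
      (All.lookup (All.all⁺ (λ t → search ws os (t ∷ M)) o ok′) t∈o)

  -- Otherwise all unknown triples are edges; together with those of `F` they make the composite of
  -- `m` with `u ◃ f` a realisation of `D`.
  obstruction-hit : ∀ {f u F D} m → Realises f F → Forbidden D →
    Any (λ t → holds (u ◃ f) t ≡ false) (unknown F D m)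
  obstruction-hit {f} {u} {F} {D} m real forb
    with Any.any? (λ t → holds (u ◃ f) t ≟ᵇ false) (unknown F D m)
  ... | yes hit = hit
  ... | no ¬hit = contradiction (All.tabulate image-holds) (forb ((u ◃ f) ∘ at m))
    where
    shifted : Realises (u ◃ f) (map shift F)
    shifted = All.map⁺ real
    image-holds : ∀ {t} → t ∈ D → holds ((u ◃ f) ∘ at m) t ≡ true
    image-holds {t} t∈D with sort (image m t) ∈? map shift F
    ... | yes known = trans (sym (holds-sort (u ◃ f) (image m t))) (All.lookup shifted known)
    ... | no  new   = trans (sym (holds-sort (u ◃ f) (image m t))) (¬-not λ t∉H → ¬hit (lose
      (∈-filter⁺ (λ t → ¬? (t ∈? map shift F)) (∈-map⁺ (sort ∘ image m) t∈D) new) t∉H))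

  obstructions-hit : ∀ {f u F} Ds → Realises f F → All (Forbidden ∘ proj₁) Ds →
    All (Any (λ t → holds (u ◃ f) t ≡ false)) (obstructions F Ds)
  obstructions-hit []              real []            = []
  obstructions-hit ((D , ms) ∷ Ds) real (forb ∷ forbs) =
    All.++⁺ (All.map⁺ (All.universal (λ m → obstruction-hit m real forb) ms)) (obstructions-hit Ds real forbs)

  -- Double counting: summed over all `u`, a pair of weight `w` contributes `w` times its co-degree.
  Σ-score : ∀ f ws → (∀ {a b w} → (a , b , w) ∈ ws → δ₂⁺ H ≤ codeg H (f a) (f b)) →
    total ws ℕ.* δ₂⁺ H ≤ sum (map (λ u → score f u ws) (allFin n))
  Σ-score f []                 pos = z≤n
  Σ-score f ((a , b , w) ∷ ws) pos = begin
    (w ℕ.+ total ws) ℕ.* δ₂⁺ H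
      ≡⟨ ℕ.*-distribʳ-+ (δ₂⁺ H) w (total ws) ⟩
    w ℕ.* δ₂⁺ H ℕ.+ total ws ℕ.* δ₂⁺ H
      ≤⟨ ℕ.+-mono-≤ (ℕ.*-monoʳ-≤ w (pos (here refl))) (Σ-score f ws (pos ∘ there)) ⟩
    w ℕ.* codeg H (f a) (f b) ℕ.+ sum (map (λ u → score f u ws) (allFin n))
      ≡⟨ cong (ℕ._+ _) (sum-map-if w (edge H (f a) (f b)) (allFin n)) ⟨
    sum (map (λ u → if edge H (f a) (f b) u then w else 0) (allFin n))
      ℕ.+ sum (map (λ u → score f u ws) (allFin n))
      ≡⟨ sum-map-+ _ (λ u → score f u ws) (allFin n) ⟨
    sum (map (λ u → score f u ((a , b , w) ∷ ws)) (allFin n)) ∎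
    where open ℕ.≤-Reasoning

  covered-sound : ∀ {f F} → Realises f F → ∀ a b {w} → T (covered F (a , b , w)) →
    δ₂⁺ H ≤ codeg H (f a) (f b)
  covered-sound {f} {F} real a b ok
    with c , ok′ ← Any.satisfied (Any.any⁻ (λ c → does (sort (a , b , c) ∈? F)) (upTo 7) ok)
    with yes t∈F ← sort (a , b , c) ∈? F
    = δ₂⁺≤codeg {z = f c} (trans (sym (holds-sort f (a , b , c))) (All.lookup real t∈F))

  -- The averaging step in contrapositive form: a realisation of `F` would let every `u` score at
  -- most 4/7 of the total, and summing over `u` contradicts `dense`. The implicit argument is
  -- solved by evaluating `check`.
  certified : 4 ℕ.* n ℕ.< 7 ℕ.* δ₂⁺ H → ∀ F ws Ds {_ : T (check F ws Ds)} →
    All (Forbidden ∘ proj₁) Ds → Forbidden F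
  certified dense F ws Ds {ok} forbs f real = ℕ.<⇒≱ dense
    (ℕ.*-cancelˡ-≤ (total ws) {{ℕ.>-nonZero (ℕ.≤ᵇ⇒≤ 1 _ total>0)}} (begin
    total ws ℕ.* (7 ℕ.* δ₂⁺ H)
      ≡⟨ pull (total ws) (δ₂⁺ H) ⟩
    7 ℕ.* (total ws ℕ.* δ₂⁺ H)
      ≤⟨ ℕ.*-monoʳ-≤ 7 (Σ-score f ws λ {a} {b} {w} p → covered-sound real a b {w} (All.lookup (All.all⁺ (covered F) ws cov) p)) ⟩
    7 ℕ.* sum (map (λ u → score f u ws) (allFin n))
      ≡⟨ sum-map-* 7 (λ u → score f u ws) (allFin n) ⟨
    sum (map (λ u → 7 ℕ.* score f u ws) (allFin n))
      ≤⟨ sum-map-≤ _ (4 ℕ.* total ws) (allFin n)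
           (λ u → search-sound f u ws (obstructions F Ds) [] (obstructions-hit Ds real forbs) searched) ⟩
    length (allFin n) ℕ.* (4 ℕ.* total ws)
      ≡⟨ cong (ℕ._* _) (length-tabulate {n = n} id) ⟩
    n ℕ.* (4 ℕ.* total ws)
      ≡⟨ rotate n (total ws) ⟩
    total ws ℕ.* (4 ℕ.* n) ∎))
    where
    open ℕ.≤-Reasoning
    checks = Equivalence.to T-∧ ok
    total>0 = proj₁ checks
    cov = proj₁ (Equivalence.to (T-∧ {all (covered F) ws}) (proj₂ checks))
    searched = proj₂ (Equivalence.to (T-∧ {all (covered F) ws}) (proj₂ checks))
    pull : ∀ t d → t ℕ.* (7 ℕ.* d) ≡ 7 ℕ.* (t ℕ.* d)
    pull = solve-∀
    rotate : ∀ n t → n ℕ.* (4 ℕ.* t) ≡ t ℕ.* (4 ℕ.* n)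
    rotate = solve-∀

-- The configurations to be excluded.

J₄-triples : Config
J₄-triples =
  (0 , 1 , 2) ∷ (0 , 1 , 3) ∷ (0 , 1 , 4) ∷ (0 , 2 , 3) ∷ (0 , 2 , 4) ∷ (0 , 3 , 4) ∷ []

C₇ : Config
C₇ =
  (0 , 1 , 6) ∷ (0 , 2 , 3) ∷ (0 , 2 , 4) ∷ (0 , 3 , 4) ∷ (0 , 3 , 5) ∷ (0 , 3 , 6) ∷
  (0 , 4 , 6) ∷ (0 , 5 , 6) ∷ (1 , 2 , 3) ∷ (1 , 2 , 6) ∷ (1 , 3 , 4) ∷ (1 , 3 , 5) ∷
  (1 , 3 , 6) ∷ (2 , 3 , 4) ∷ (2 , 3 , 6) ∷ (2 , 4 , 6) ∷ (2 , 5 , 6) ∷ (3 , 4 , 5) ∷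
  (3 , 5 , 6) ∷ []

-- `C₆` and `C₆′` both extend a copy of `C₅` by a vertex with seven link pairs: vertex 0 here,
-- vertex 1 in `C₆′`.
C₆ : Config
C₆ =
  (0 , 1 , 2) ∷ (0 , 1 , 5) ∷ (0 , 2 , 3) ∷ (0 , 2 , 4) ∷ (0 , 2 , 5) ∷ (0 , 3 , 4) ∷
  (0 , 3 , 5) ∷ (1 , 2 , 3) ∷ (1 , 2 , 5) ∷ (1 , 3 , 4) ∷ (1 , 3 , 5) ∷ (1 , 4 , 5) ∷
  (2 , 3 , 4) ∷ (2 , 4 , 5) ∷ (3 , 4 , 5) ∷ []

C₆′ : Config
C₆′ =
  (0 , 1 , 2) ∷ (0 , 1 , 4) ∷ (0 , 1 , 5) ∷ (0 , 2 , 3) ∷ (0 , 2 , 4) ∷ (0 , 3 , 4) ∷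
  (0 , 3 , 5) ∷ (0 , 4 , 5) ∷ (1 , 2 , 3) ∷ (1 , 2 , 5) ∷ (1 , 3 , 4) ∷ (1 , 4 , 5) ∷
  (2 , 3 , 4) ∷ (2 , 3 , 5) ∷ (2 , 4 , 5) ∷ []

-- All triples on five vertices except 013 and 124; equivalently a `K₄` on 0, 2, 3, 4 and a vertex 1
-- whose link is a 4-cycle.
C₅ : Config
C₅ =
  (0 , 1 , 2) ∷ (0 , 1 , 4) ∷ (0 , 2 , 3) ∷ (0 , 2 , 4) ∷ (0 , 3 , 4) ∷ (1 , 2 , 3) ∷
  (1 , 3 , 4) ∷ (2 , 3 , 4) ∷ []

K₄ : Config
K₄ =
  (0 , 1 , 2) ∷ (0 , 1 , 3) ∷ (0 , 2 , 3) ∷ (1 , 2 , 3) ∷ []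

-- A copy of `D₅` on 0, 2, 3, 4, 5 and a vertex 1 with four link pairs.
D₆ : Config
D₆ =
  (0 , 1 , 2) ∷ (0 , 2 , 3) ∷ (0 , 2 , 4) ∷ (0 , 3 , 5) ∷ (0 , 4 , 5) ∷ (1 , 2 , 3) ∷
  (1 , 3 , 4) ∷ (1 , 3 , 5) ∷ (2 , 3 , 4) ∷ (2 , 4 , 5) ∷ (3 , 4 , 5) ∷ []

-- `C₅` without 034, which destroys its only `K₄`.
D₅ : Config
D₅ =
  (0 , 1 , 2) ∷ (0 , 1 , 4) ∷ (0 , 2 , 3) ∷ (0 , 2 , 4) ∷ (1 , 2 , 3) ∷ (1 , 3 , 4) ∷
  (2 , 3 , 4) ∷ []

K₄⁻ : Config
K₄⁻ =
  (0 , 1 , 2) ∷ (0 , 1 , 3) ∷ (0 , 2 , 3) ∷ []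

E₃ : Config
E₃ =
  (0 , 1 , 2) ∷ []

-- Upper bound: the chain of exclusions.

module UpperBound {n} (H : ThreeGraph n) (J₄-free : (J₄ -free) H) where

  open CoDegree H
  open Configurations H

  -- Unfolding these decision procedures on open terms is prohibitively expensive.
  abstract
    J₄-edge⇒triple : ∀ a b c → edge J₄ a b c ≡ true → sort (toℕ a , toℕ b , toℕ c) ∈ J₄-triples
    J₄-edge⇒triple = toWitness {a? = all? λ a → all? λ b → all? λ c →
      (edge J₄ a b c ≟ᵇ true) →-dec (sort (toℕ a , toℕ b , toℕ c) ∈? J₄-triples)} _

    J₄-covers-pairs : ∀ a b → a ≡ b ⊎ ∃ λ c → edge J₄ a b c ≡ true
    J₄-covers-pairs = toWitness {a? = all? λ a → all? λ b →
      (a ≟ᶠ b) ⊎-dec any? λ c → edge J₄ a b c ≟ᵇ true} _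

  J₄-forbidden : Forbidden J₄-triples
  J₄-forbidden f real = J₄-free (g , injective , preserves)
    where
    g : Fin 5 → Fin n
    g = f ∘ toℕ
    preserves : ∀ a b c → edge J₄ a b c ≡ true → edge H (g a) (g b) (g c) ≡ true
    preserves a b c e =
      trans (sym (holds-sort f (toℕ a , toℕ b , toℕ c))) (All.lookup real (J₄-edge⇒triple a b c e))
    -- Distinct labels share an edge of `J₄`, so identifying their images would give an edge with a
    -- repeated vertex.
    injective : ∀ {a b} → g a ≡ g b → a ≡ b
    injective {a} {b} ga≡gb with J₄-covers-pairs a b
    ... | inj₁ a≡b     = a≡b
    ... | inj₂ (c , e) with () ← trans (sym (preserves a b c e))
                                   (trans (cong (λ x → edge H x (g b) (g c)) ga≡gb) (irr H (g b) (g c)))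

  module Dense (dense : 4 ℕ.* n ℕ.< 7 ℕ.* δ₂⁺ H) where

    -- Of the fourteen unit weights at least six must be lost. In each map the value 0 is the new
    -- vertex and `suc i` is vertex `i` of `C₇`.
    C₇-forbidden : Forbidden C₇
    C₇-forbidden =
      certified dense C₇
        ((0 , 3 , 1) ∷ (0 , 4 , 1) ∷ (0 , 5 , 1) ∷ (0 , 6 , 1) ∷ (1 , 2 , 1) ∷ (1 , 3 , 1) ∷
         (1 , 6 , 1) ∷ (2 , 3 , 1) ∷ (2 , 4 , 1) ∷ (2 , 6 , 1) ∷ (3 , 4 , 1) ∷ (3 , 5 , 1) ∷
         (3 , 6 , 1) ∷ (5 , 6 , 1) ∷ [])
        ((J₄-triples ,
             (6 ∷ 0 ∷ 1 ∷ 4 ∷ 7 ∷ []) ∷ (7 ∷ 0 ∷ 2 ∷ 3 ∷ 4 ∷ []) ∷ (1 ∷ 0 ∷ 4 ∷ 5 ∷ 7 ∷ []) ∷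
             (4 ∷ 0 ∷ 2 ∷ 3 ∷ 5 ∷ []) ∷ (4 ∷ 0 ∷ 2 ∷ 6 ∷ 7 ∷ []) ∷ (1 ∷ 0 ∷ 4 ∷ 6 ∷ 7 ∷ []) ∷
             (3 ∷ 0 ∷ 4 ∷ 5 ∷ 7 ∷ []) ∷ (2 ∷ 0 ∷ 3 ∷ 4 ∷ 7 ∷ []) ∷ (5 ∷ 0 ∷ 1 ∷ 3 ∷ 4 ∷ []) ∷
             (4 ∷ 0 ∷ 1 ∷ 3 ∷ 7 ∷ []) ∷ (3 ∷ 0 ∷ 2 ∷ 4 ∷ 7 ∷ []) ∷ (4 ∷ 0 ∷ 1 ∷ 5 ∷ 6 ∷ []) ∷
             (7 ∷ 0 ∷ 1 ∷ 4 ∷ 6 ∷ []) ∷ (7 ∷ 0 ∷ 1 ∷ 2 ∷ 4 ∷ []) ∷ (7 ∷ 0 ∷ 3 ∷ 4 ∷ 6 ∷ []) ∷ []) ∷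
         [])
        (J₄-forbidden ∷ [])

    C₆-forbidden : Forbidden C₆
    C₆-forbidden =
      certified dense C₆
        ((0 , 2 , 2) ∷ (0 , 3 , 2) ∷ (0 , 5 , 2) ∷ (1 , 2 , 2) ∷ (1 , 3 , 2) ∷ (1 , 5 , 2) ∷
         (2 , 3 , 2) ∷ (2 , 4 , 1) ∷ (3 , 4 , 3) ∷ (3 , 5 , 2) ∷ (4 , 5 , 1) ∷ [])
        ((J₄-triples ,
             (4 ∷ 0 ∷ 1 ∷ 5 ∷ 6 ∷ []) ∷ (4 ∷ 0 ∷ 1 ∷ 3 ∷ 5 ∷ []) ∷ (4 ∷ 0 ∷ 2 ∷ 5 ∷ 6 ∷ []) ∷
             (4 ∷ 0 ∷ 2 ∷ 3 ∷ 5 ∷ []) ∷ (5 ∷ 0 ∷ 3 ∷ 4 ∷ 6 ∷ []) ∷ (1 ∷ 0 ∷ 3 ∷ 4 ∷ 6 ∷ []) ∷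
             (2 ∷ 0 ∷ 3 ∷ 4 ∷ 6 ∷ []) ∷ (6 ∷ 0 ∷ 1 ∷ 2 ∷ 4 ∷ []) ∷ (3 ∷ 0 ∷ 1 ∷ 2 ∷ 4 ∷ []) ∷
             (6 ∷ 0 ∷ 2 ∷ 4 ∷ 5 ∷ []) ∷ (3 ∷ 0 ∷ 1 ∷ 4 ∷ 5 ∷ []) ∷ []) ∷
         (C₇ ,
             (5 ∷ 0 ∷ 2 ∷ 4 ∷ 6 ∷ 1 ∷ 3 ∷ []) ∷ (5 ∷ 0 ∷ 1 ∷ 4 ∷ 3 ∷ 2 ∷ 6 ∷ []) ∷ []) ∷
         [])
        (J₄-forbidden ∷ C₇-forbidden ∷ [])

    C₆′-forbidden : Forbidden C₆′
    C₆′-forbidden =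
      certified dense C₆′
        ((0 , 1 , 2) ∷ (0 , 2 , 2) ∷ (0 , 3 , 1) ∷ (0 , 4 , 3) ∷ (0 , 5 , 1) ∷ (1 , 2 , 2) ∷
         (1 , 4 , 1) ∷ (1 , 5 , 2) ∷ (2 , 3 , 2) ∷ (2 , 4 , 1) ∷ (2 , 5 , 1) ∷ (3 , 4 , 1) ∷
         (4 , 5 , 2) ∷ [])
        ((J₄-triples ,
             (1 ∷ 0 ∷ 2 ∷ 3 ∷ 5 ∷ []) ∷ (3 ∷ 0 ∷ 1 ∷ 2 ∷ 4 ∷ []) ∷ (5 ∷ 0 ∷ 1 ∷ 3 ∷ 6 ∷ []) ∷
             (2 ∷ 0 ∷ 1 ∷ 3 ∷ 6 ∷ []) ∷ (1 ∷ 0 ∷ 2 ∷ 5 ∷ 6 ∷ []) ∷ (5 ∷ 0 ∷ 1 ∷ 2 ∷ 6 ∷ []) ∷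
             (1 ∷ 0 ∷ 3 ∷ 4 ∷ 5 ∷ []) ∷ (3 ∷ 0 ∷ 1 ∷ 4 ∷ 5 ∷ []) ∷ (2 ∷ 0 ∷ 1 ∷ 5 ∷ 6 ∷ []) ∷
             (3 ∷ 0 ∷ 2 ∷ 4 ∷ 6 ∷ []) ∷ (5 ∷ 0 ∷ 1 ∷ 2 ∷ 4 ∷ []) ∷ (6 ∷ 0 ∷ 2 ∷ 3 ∷ 5 ∷ []) ∷
             (6 ∷ 0 ∷ 1 ∷ 2 ∷ 5 ∷ []) ∷ (4 ∷ 0 ∷ 1 ∷ 3 ∷ 5 ∷ []) ∷ (1 ∷ 0 ∷ 4 ∷ 5 ∷ 6 ∷ []) ∷ []) ∷
         (C₆ ,
             (0 ∷ 2 ∷ 3 ∷ 1 ∷ 5 ∷ 6 ∷ []) ∷ (0 ∷ 1 ∷ 3 ∷ 5 ∷ 6 ∷ 2 ∷ []) ∷ []) ∷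
         (C₇ ,
             (5 ∷ 0 ∷ 3 ∷ 1 ∷ 4 ∷ 6 ∷ 2 ∷ []) ∷ (5 ∷ 0 ∷ 2 ∷ 1 ∷ 6 ∷ 4 ∷ 3 ∷ []) ∷ []) ∷
         [])
        (J₄-forbidden ∷ C₆-forbidden ∷ C₇-forbidden ∷ [])

    C₅-forbidden : Forbidden C₅
    C₅-forbidden =
      certified dense C₅
        ((0 , 1 , 1) ∷ (0 , 2 , 2) ∷ (0 , 3 , 1) ∷ (0 , 4 , 2) ∷ (1 , 2 , 1) ∷ (1 , 3 , 1) ∷
         (1 , 4 , 1) ∷ (2 , 3 , 2) ∷ (2 , 4 , 1) ∷ (3 , 4 , 2) ∷ [])
        ((J₄-triples ,
             (5 ∷ 0 ∷ 1 ∷ 3 ∷ 4 ∷ []) ∷ (4 ∷ 0 ∷ 2 ∷ 3 ∷ 5 ∷ []) ∷ (3 ∷ 0 ∷ 1 ∷ 4 ∷ 5 ∷ []) ∷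
             (1 ∷ 0 ∷ 3 ∷ 4 ∷ 5 ∷ []) ∷ (4 ∷ 0 ∷ 1 ∷ 3 ∷ 5 ∷ []) ∷ (5 ∷ 0 ∷ 1 ∷ 2 ∷ 4 ∷ []) ∷
             (1 ∷ 0 ∷ 2 ∷ 3 ∷ 5 ∷ []) ∷ (3 ∷ 0 ∷ 1 ∷ 2 ∷ 4 ∷ []) ∷ []) ∷
         (C₆ ,
             (0 ∷ 1 ∷ 2 ∷ 5 ∷ 4 ∷ 3 ∷ []) ∷ (0 ∷ 3 ∷ 2 ∷ 4 ∷ 5 ∷ 1 ∷ []) ∷
             (0 ∷ 1 ∷ 2 ∷ 3 ∷ 4 ∷ 5 ∷ []) ∷ (0 ∷ 3 ∷ 2 ∷ 1 ∷ 5 ∷ 4 ∷ []) ∷ []) ∷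
         (C₆′ ,
             (5 ∷ 0 ∷ 3 ∷ 4 ∷ 1 ∷ 2 ∷ []) ∷ (1 ∷ 0 ∷ 4 ∷ 3 ∷ 5 ∷ 2 ∷ []) ∷
             (1 ∷ 0 ∷ 4 ∷ 5 ∷ 3 ∷ 2 ∷ []) ∷ (4 ∷ 0 ∷ 1 ∷ 3 ∷ 5 ∷ 2 ∷ []) ∷
             (5 ∷ 0 ∷ 3 ∷ 1 ∷ 4 ∷ 2 ∷ []) ∷ (4 ∷ 0 ∷ 1 ∷ 5 ∷ 3 ∷ 2 ∷ []) ∷
             (3 ∷ 0 ∷ 5 ∷ 4 ∷ 1 ∷ 2 ∷ []) ∷ (3 ∷ 0 ∷ 5 ∷ 1 ∷ 4 ∷ 2 ∷ []) ∷ []) ∷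
         [])
        (J₄-forbidden ∷ C₆-forbidden ∷ C₆′-forbidden ∷ [])

    -- If `u` completes four of the six pairs, these have a vertex of degree three, giving `J₄`, or
    -- form a 4-cycle, giving `C₅`. The maps list the four stars and the three 4-cycles.
    K₄-forbidden : Forbidden K₄
    K₄-forbidden =
      certified dense K₄
        ((0 , 1 , 1) ∷ (0 , 2 , 1) ∷ (0 , 3 , 1) ∷ (1 , 2 , 1) ∷ (1 , 3 , 1) ∷ (2 , 3 , 1) ∷ [])
        ((J₄-triples ,
             (2 ∷ 0 ∷ 1 ∷ 3 ∷ 4 ∷ []) ∷ (3 ∷ 0 ∷ 1 ∷ 2 ∷ 4 ∷ []) ∷ (1 ∷ 0 ∷ 2 ∷ 3 ∷ 4 ∷ []) ∷
             (4 ∷ 0 ∷ 1 ∷ 2 ∷ 3 ∷ []) ∷ []) ∷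
         (C₅ ,
             (1 ∷ 0 ∷ 2 ∷ 4 ∷ 3 ∷ []) ∷ (1 ∷ 0 ∷ 2 ∷ 3 ∷ 4 ∷ []) ∷ (1 ∷ 0 ∷ 3 ∷ 2 ∷ 4 ∷ []) ∷ []) ∷
         [])
        (J₄-forbidden ∷ C₅-forbidden ∷ [])

    D₆-forbidden : Forbidden D₆
    D₆-forbidden =
      certified dense D₆
        ((0 , 2 , 1) ∷ (0 , 4 , 1) ∷ (0 , 5 , 1) ∷ (1 , 2 , 1) ∷ (1 , 3 , 1) ∷ (2 , 3 , 2) ∷
         (2 , 4 , 2) ∷ (3 , 4 , 2) ∷ (3 , 5 , 1) ∷ (4 , 5 , 2) ∷ [])
        ((K₄ ,
             (0 ∷ 3 ∷ 4 ∷ 5 ∷ []) ∷ (0 ∷ 2 ∷ 3 ∷ 4 ∷ []) ∷ (0 ∷ 4 ∷ 5 ∷ 6 ∷ []) ∷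
             (0 ∷ 1 ∷ 5 ∷ 6 ∷ []) ∷ (0 ∷ 1 ∷ 3 ∷ 5 ∷ []) ∷ []) ∷
         (J₄-triples ,
             (4 ∷ 0 ∷ 2 ∷ 3 ∷ 5 ∷ []) ∷ (4 ∷ 0 ∷ 2 ∷ 5 ∷ 6 ∷ []) ∷ (5 ∷ 0 ∷ 1 ∷ 3 ∷ 6 ∷ []) ∷
             (3 ∷ 0 ∷ 1 ∷ 4 ∷ 5 ∷ []) ∷ (5 ∷ 0 ∷ 3 ∷ 4 ∷ 6 ∷ []) ∷ (6 ∷ 0 ∷ 1 ∷ 4 ∷ 5 ∷ []) ∷
             (3 ∷ 0 ∷ 1 ∷ 2 ∷ 4 ∷ []) ∷ []) ∷
         [])
        (K₄-forbidden ∷ J₄-forbidden ∷ [])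

    D₅-forbidden : Forbidden D₅
    D₅-forbidden =
      certified dense D₅
        ((0 , 1 , 1) ∷ (0 , 2 , 1) ∷ (0 , 4 , 1) ∷ (1 , 2 , 1) ∷ (1 , 3 , 1) ∷ (1 , 4 , 1) ∷
         (2 , 3 , 1) ∷ (2 , 4 , 1) ∷ (3 , 4 , 1) ∷ [])
        ((K₄ ,
             (0 ∷ 1 ∷ 2 ∷ 5 ∷ []) ∷ (0 ∷ 1 ∷ 2 ∷ 3 ∷ []) ∷ (0 ∷ 2 ∷ 3 ∷ 4 ∷ []) ∷
             (0 ∷ 2 ∷ 4 ∷ 5 ∷ []) ∷ (0 ∷ 1 ∷ 3 ∷ 5 ∷ []) ∷ (0 ∷ 3 ∷ 4 ∷ 5 ∷ []) ∷ []) ∷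
         (J₄-triples ,
             (3 ∷ 0 ∷ 1 ∷ 2 ∷ 4 ∷ []) ∷ (1 ∷ 0 ∷ 2 ∷ 3 ∷ 5 ∷ []) ∷ (3 ∷ 0 ∷ 1 ∷ 4 ∷ 5 ∷ []) ∷ []) ∷
         (D₆ ,
             (2 ∷ 0 ∷ 4 ∷ 5 ∷ 3 ∷ 1 ∷ []) ∷ []) ∷
         [])
        (K₄-forbidden ∷ J₄-forbidden ∷ D₆-forbidden ∷ [])

    -- Four pairs form a 4-cycle or a triangle with a pendant edge. A triangle through 0 gives `K₄`;
    -- the three 4-cycles and the three graphs with triangle 123 give `D₅`.
    K₄⁻-forbidden : Forbidden K₄⁻
    K₄⁻-forbidden =
      certified dense K₄⁻
        ((0 , 1 , 1) ∷ (0 , 2 , 1) ∷ (0 , 3 , 1) ∷ (1 , 2 , 1) ∷ (1 , 3 , 1) ∷ (2 , 3 , 1) ∷ [])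
        ((K₄ ,
             (0 ∷ 1 ∷ 2 ∷ 4 ∷ []) ∷ (0 ∷ 1 ∷ 3 ∷ 4 ∷ []) ∷ (0 ∷ 1 ∷ 2 ∷ 3 ∷ []) ∷ []) ∷
         (D₅ ,
             (0 ∷ 3 ∷ 2 ∷ 1 ∷ 4 ∷ []) ∷ (3 ∷ 0 ∷ 1 ∷ 4 ∷ 2 ∷ []) ∷ (2 ∷ 0 ∷ 1 ∷ 4 ∷ 3 ∷ []) ∷
             (0 ∷ 2 ∷ 4 ∷ 1 ∷ 3 ∷ []) ∷ (2 ∷ 0 ∷ 1 ∷ 3 ∷ 4 ∷ []) ∷ (0 ∷ 2 ∷ 3 ∷ 1 ∷ 4 ∷ []) ∷ []) ∷
         [])
        (K₄-forbidden ∷ D₅-forbidden ∷ [])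

    -- Two of the three pairs completed by the same `u` give a `K₄⁻` centred at their common vertex.
    E₃-forbidden : Forbidden E₃
    E₃-forbidden =
      certified dense E₃
        ((0 , 1 , 1) ∷ (0 , 2 , 1) ∷ (1 , 2 , 1) ∷ [])
        ((K₄⁻ ,
             (2 ∷ 0 ∷ 1 ∷ 3 ∷ []) ∷ (1 ∷ 0 ∷ 2 ∷ 3 ∷ []) ∷ (3 ∷ 0 ∷ 1 ∷ 2 ∷ []) ∷ []) ∷
         [])
        (K₄⁻-forbidden ∷ [])

    δ₂⁺≢0 : δ₂⁺ H ≢ 0
    δ₂⁺≢0 δ≡0 with () ← subst (λ d → 4 ℕ.* n ℕ.< 7 ℕ.* d) δ≡0 dense

    not-dense : ⊥
    not-dense with x , y , z , e ← δ₂⁺>0⇒edge (ℕ.n≢0⇒n>0 δ₂⁺≢0) =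
      E₃-forbidden (λ { 0 → x ; 1 → y ; _ → z }) (e ∷ [])

  7δ₂⁺≤4n : 7 ℕ.* δ₂⁺ H ≤ 4 ℕ.* n
  7δ₂⁺≤4n = ℕ.≮⇒≥ Dense.not-dense

-- The Fano plane as the nonzero vectors over the field of two elements, with `xor` as addition.

det : (a b c : Bool × Bool × Bool) → Bool
det (a₁ , a₂ , a₃) (b₁ , b₂ , b₃) (c₁ , c₂ , c₃) =
  (a₁ ∧ ((b₂ ∧ c₃) xor (b₃ ∧ c₂))) xor
  ((a₂ ∧ ((b₁ ∧ c₃) xor (b₃ ∧ c₁))) xor
   (a₃ ∧ ((b₁ ∧ c₂) xor (b₂ ∧ c₁))))

point : Fin 7 → Bool × Bool × Bool
point = Data.Vec.lookup
  ( (true  , false , false) Data.Vec.∷ (false , true  , false) Data.Vec.∷ (false , false , true) Data.Vec.∷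
    (true  , true  , false) Data.Vec.∷ (false , true  , true)  Data.Vec.∷ (true  , true  , true) Data.Vec.∷
    (true  , false , true)  Data.Vec.∷ Data.Vec.[])

-- Three points of the Fano plane are independent iff they are distinct and not on a line.
independent : Fin 7 → Fin 7 → Fin 7 → Bool
independent i j k = det (point i) (point j) (point k)

abstract
  independent-sym₁₂ : ∀ i j k → independent i j k ≡ independent j i k
  independent-sym₁₂ = toWitness {a? = all? λ i → all? λ j → all? λ k →
    independent i j k ≟ᵇ independent j i k} _

  independent-sym₂₃ : ∀ i j k → independent i j k ≡ independent i k j
  independent-sym₂₃ = toWitness {a? = all? λ i → all? λ j → all? λ k →
    independent i j k ≟ᵇ independent i k j} _

  independent-irr : ∀ i k → independent i i k ≡ false
  independent-irr = toWitness {a? = all? λ i → all? λ k → independent i i k ≟ᵇ false} _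

  -- The first alternative is the case `i ≡ j`.
  independent-codegree : ∀ i j →
    (∀ k → independent i j k ≡ false) ⊎ sum (tabulate λ k → if independent i j k then 1 else 0) ≡ 4
  independent-codegree = toWitness {a? = all? λ i → all? λ j →
    all? (λ k → independent i j k ≟ᵇ false) ⊎-dec
    (sum (tabulate λ k → if independent i j k then 1 else 0) ℕ.≟ 4)} _

  -- The three lines through `v` split the other six points into pairs, so two of `a`, `b`, `c`, `d`
  -- lie on one line with `v`. Premises precede later quantifiers to prune the enumeration.
  independent-link-K₄-free : ∀ v a b → independent v a b ≡ true →
    ∀ c → independent v a c ≡ true → independent v b c ≡ true →
    ∀ d → independent v a d ≡ true → independent v b d ≡ true → independent v c d ≡ true → ⊥
  independent-link-K₄-free = toWitness {a? = all? λ v → all? λ a → all? λ b →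
    (independent v a b ≟ᵇ true) →-dec all? λ c →
    (independent v a c ≟ᵇ true) →-dec (independent v b c ≟ᵇ true) →-dec all? λ d →
    (independent v a d ≟ᵇ true) →-dec (independent v b d ≟ᵇ true) →-dec
    (independent v c d ≟ᵇ true) →-dec no id} _

-- The blow-up and its co-degrees.

part : ℕ → Fin 7
part 0 = # 0
part 1 = # 1
part 2 = # 2
part 3 = # 3
part 4 = # 4
part 5 = # 5
part 6 = # 6
part (suc (suc (suc (suc (suc (suc (suc n))))))) = part n

-- Each full block of seven vertices contributes 4. The at most six remaining ones may contribute
-- nothing, whence the error 4 · 6 = 24.
part-sum : ∀ (h : Fin 7 → ℕ) → sum (tabulate h) ≡ 4 → ∀ n →
  4 ℕ.* n ≤ 7 ℕ.* sum (tabulate {n = n} (h ∘ part ∘ toℕ)) ℕ.+ 24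
part-sum h h≡4 (suc (suc (suc (suc (suc (suc (suc n))))))) = begin
  4 ℕ.* (7 ℕ.+ n)              ≡⟨ ℕ.*-distribˡ-+ 4 7 n ⟩
  28 ℕ.+ 4 ℕ.* n               ≤⟨ ℕ.+-monoʳ-≤ 28 (part-sum h h≡4 n) ⟩
  28 ℕ.+ (7 ℕ.* S ℕ.+ 24)      ≡⟨ regroup S ⟩
  7 ℕ.* (4 ℕ.+ S) ℕ.+ 24       ≡⟨ cong (λ s → 7 ℕ.* (s ℕ.+ S) ℕ.+ 24) h≡4 ⟨
  7 ℕ.* (sum (tabulate h) ℕ.+ S) ℕ.+ 24
    ≡⟨ cong (λ s → 7 ℕ.* s ℕ.+ 24) (assoc (h (# 0)) (h (# 1)) (h (# 2)) (h (# 3)) (h (# 4)) (h (# 5)) (h (# 6)) S) ⟩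
  7 ℕ.* sum (tabulate {n = 7 ℕ.+ n} (h ∘ part ∘ toℕ)) ℕ.+ 24 ∎
  where
  open ℕ.≤-Reasoning
  S = sum (tabulate {n = n} (h ∘ part ∘ toℕ))
  regroup : ∀ s → 28 ℕ.+ (7 ℕ.* s ℕ.+ 24) ≡ 7 ℕ.* (4 ℕ.+ s) ℕ.+ 24
  regroup = solve-∀
  assoc : ∀ a b c d e f g s →
    (a ℕ.+ (b ℕ.+ (c ℕ.+ (d ℕ.+ (e ℕ.+ (f ℕ.+ (g ℕ.+ 0))))))) ℕ.+ s ≡
    a ℕ.+ (b ℕ.+ (c ℕ.+ (d ℕ.+ (e ℕ.+ (f ℕ.+ (g ℕ.+ s))))))
  assoc = solve-∀
part-sum h _ 0 = z≤n
part-sum h _ 1 = ℕ.m≤n⇒m≤o+n (7 ℕ.* sum (tabulate {n = 1} (h ∘ part ∘ toℕ))) (ℕ.≤ᵇ⇒≤ 4 24 _)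
part-sum h _ 2 = ℕ.m≤n⇒m≤o+n (7 ℕ.* sum (tabulate {n = 2} (h ∘ part ∘ toℕ))) (ℕ.≤ᵇ⇒≤ 8 24 _)
part-sum h _ 3 = ℕ.m≤n⇒m≤o+n (7 ℕ.* sum (tabulate {n = 3} (h ∘ part ∘ toℕ))) (ℕ.≤ᵇ⇒≤ 12 24 _)
part-sum h _ 4 = ℕ.m≤n⇒m≤o+n (7 ℕ.* sum (tabulate {n = 4} (h ∘ part ∘ toℕ))) (ℕ.≤ᵇ⇒≤ 16 24 _)
part-sum h _ 5 = ℕ.m≤n⇒m≤o+n (7 ℕ.* sum (tabulate {n = 5} (h ∘ part ∘ toℕ))) (ℕ.≤ᵇ⇒≤ 20 24 _)
part-sum h _ 6 = ℕ.m≤n⇒m≤o+n (7 ℕ.* sum (tabulate {n = 6} (h ∘ part ∘ toℕ))) (ℕ.≤ᵇ⇒≤ 24 24 _)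

fanoBlowup : ∀ n → ThreeGraph n
fanoBlowup n = record
  { edge  = λ a b c → independent (p a) (p b) (p c)
  ; sym₁₂ = λ a b c → independent-sym₁₂ (p a) (p b) (p c)
  ; sym₂₃ = λ a b c → independent-sym₂₃ (p a) (p b) (p c)
  ; irr   = λ a c → independent-irr (p a) (p c)
  }
  where
  p : Fin n → Fin 7
  p = part ∘ toℕ

fanoBlowup-J₄-free : ∀ n → (J₄ -free) (fanoBlowup n)
fanoBlowup-J₄-free n (f , _ , hom) = independent-link-K₄-free (p (# 0)) (p (# 1)) (p (# 2)) (hom _ _ _ refl)
  (p (# 3)) (hom (# 0) (# 1) (# 3) refl) (hom (# 0) (# 2) (# 3) refl)
  (p (# 4)) (hom (# 0) (# 1) (# 4) refl) (hom (# 0) (# 2) (# 4) refl) (hom (# 0) (# 3) (# 4) refl)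
  where
  p : Fin 5 → Fin 7
  p = part ∘ toℕ ∘ f

4n≤7codeg-fanoBlowup : ∀ n x y → 1 ≤ codeg (fanoBlowup n) x y → 4 ℕ.* n ≤ 7 ℕ.* codeg (fanoBlowup n) x y ℕ.+ 24
4n≤7codeg-fanoBlowup n x y 1≤codeg = bound (independent-codegree i j)
  where
  open ℕ.≤-Reasoning
  i j : Fin 7
  i = part (toℕ x)
  j = part (toℕ y)
  h : Fin 7 → ℕ
  h k = if independent i j k then 1 else 0
  bound : (∀ k → independent i j k ≡ false) ⊎ sum (tabulate h) ≡ 4 →
    4 ℕ.* n ≤ 7 ℕ.* codeg (fanoBlowup n) x y ℕ.+ 24
  -- Here `x` and `y` lie in the same part and have co-degree 0.
  bound (inj₁ none) =
    let z , e = indicator-sum-witness (edge (fanoBlowup n) x y) (allFin n) 1≤codeg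
    in contradiction (trans (sym e) (none (part (toℕ z)))) λ ()
  bound (inj₂ four) = begin
    4 ℕ.* n
      ≤⟨ part-sum h four n ⟩
    7 ℕ.* sum (tabulate {n = n} (h ∘ part ∘ toℕ)) ℕ.+ 24
      ≡⟨ cong (λ ks → 7 ℕ.* sum ks ℕ.+ 24) (map-tabulate {n = n} id (h ∘ part ∘ toℕ)) ⟨
    7 ℕ.* codeg (fanoBlowup n) x y ℕ.+ 24 ∎

4n≤7δ₂⁺-fanoBlowup : ∀ n → 3 ≤ n → 4 ℕ.* n ≤ 7 ℕ.* δ₂⁺ (fanoBlowup n) ℕ.+ 24
4n≤7δ₂⁺-fanoBlowup n (s≤s (s≤s (s≤s _))) =
  let x , y , δ≡codeg , 1≤codeg =
        -- The first three vertices lie in the parts of the three unit vectors, hence form an edge.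
        CoDegree.δ₂⁺-attained (fanoBlowup n) {zero} {suc zero} {suc (suc zero)} refl
  in subst (λ d → 4 ℕ.* n ≤ 7 ℕ.* d ℕ.+ 24) (sym δ≡codeg) (4n≤7codeg-fanoBlowup n x y 1≤codeg)

-- Passing between rational and natural inequalities.

toℚᵘ-*n/1 : ∀ p n → ℚ.toℚᵘ (p * (+ n / 1)) ℚᵘ.≃ ℚ.toℚᵘ p ℚᵘ.* ℚᵘ.mkℚᵘ (+ n) 0
toℚᵘ-*n/1 p n = ℚᵘ.≃-trans (ℚ.toℚᵘ-homo-* p (+ n / 1))
  (ℚᵘ.*-congˡ {ℚ.toℚᵘ p} (ℚ.toℚᵘ-fromℚᵘ (ℚᵘ.mkℚᵘ (+ n) 0)))

p*n≤m : ∀ p a n m → ℚ.↥ p ≡ + a → a ℕ.* n ≤ m ℕ.* ℚ.↧ₙ p → p * (+ n / 1) ≤ℚ + m / 1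
p*n≤m p@(ℚ.mkℚ _ b-1 _) a n m refl an≤mb = ℚ.toℚᵘ-cancel-≤ (begin
  ℚ.toℚᵘ (p * (+ n / 1))           ≃⟨ toℚᵘ-*n/1 p n ⟩
  ℚ.toℚᵘ p ℚᵘ.* ℚᵘ.mkℚᵘ (+ n) 0    ≤⟨ ℚᵘ.*≤* cross ⟩
  ℚᵘ.mkℚᵘ (+ m) 0                  ≃⟨ ℚ.toℚᵘ-fromℚᵘ (ℚᵘ.mkℚᵘ (+ m) 0) ⟨
  ℚ.toℚᵘ (+ m / 1)                 ∎)
  where
  open ℚᵘ.≤-Reasoning
  cross : (+ a ℤ.* + n) ℤ.* + 1 ℤ.≤ + m ℤ.* + (suc b-1 ℕ.* 1)
  cross rewrite ℤ.*-identityʳ (+ a ℤ.* + n) | sym (ℤ.pos-* a n) | ℕ.*-identityʳ (suc b-1)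
    | sym (ℤ.pos-* m (suc b-1)) = ℤ.+≤+ an≤mb

m≤p*n : ∀ p a n m → ℚ.↥ p ≡ + a → m ℕ.* ℚ.↧ₙ p ≤ a ℕ.* n → + m / 1 ≤ℚ p * (+ n / 1)
m≤p*n p@(ℚ.mkℚ _ b-1 _) a n m refl mb≤an = ℚ.toℚᵘ-cancel-≤ (begin
  ℚ.toℚᵘ (+ m / 1)                 ≃⟨ ℚ.toℚᵘ-fromℚᵘ (ℚᵘ.mkℚᵘ (+ m) 0) ⟩
  ℚᵘ.mkℚᵘ (+ m) 0                  ≤⟨ ℚᵘ.*≤* cross ⟩
  ℚ.toℚᵘ p ℚᵘ.* ℚᵘ.mkℚᵘ (+ n) 0    ≃⟨ toℚᵘ-*n/1 p n ⟨
  ℚ.toℚᵘ (p * (+ n / 1))           ∎)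
  where
  open ℚᵘ.≤-Reasoning
  cross : + m ℤ.* + (suc b-1 ℕ.* 1) ℤ.≤ (+ a ℤ.* + n) ℤ.* + 1
  cross rewrite ℤ.*-identityʳ (+ a ℤ.* + n) | sym (ℤ.pos-* a n) | ℕ.*-identityʳ (suc b-1)
    | sym (ℤ.pos-* m (suc b-1)) = ℤ.+≤+ mb≤an

/1-homo-+ : ∀ m k → + (m ℕ.+ k) / 1 ≡ + m / 1 + + k / 1
/1-homo-+ m k = ℚ.toℚᵘ-injective (begin-equality
  ℚ.toℚᵘ (+ (m ℕ.+ k) / 1)                  ≃⟨ ℚ.toℚᵘ-fromℚᵘ (ℚᵘ.mkℚᵘ (+ (m ℕ.+ k)) 0) ⟩
  ℚᵘ.mkℚᵘ (+ (m ℕ.+ k)) 0                   ≃⟨ ℚᵘ.*≡* cross ⟩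
  ℚᵘ.mkℚᵘ (+ m) 0 ℚᵘ.+ ℚᵘ.mkℚᵘ (+ k) 0      ≃⟨ ℚᵘ.+-cong (ℚ.toℚᵘ-fromℚᵘ (ℚᵘ.mkℚᵘ (+ m) 0)) (ℚ.toℚᵘ-fromℚᵘ (ℚᵘ.mkℚᵘ (+ k) 0)) ⟨
  ℚ.toℚᵘ (+ m / 1) ℚᵘ.+ ℚ.toℚᵘ (+ k / 1)    ≃⟨ ℚ.toℚᵘ-homo-+ (+ m / 1) (+ k / 1) ⟨
  ℚ.toℚᵘ (+ m / 1 + + k / 1)                ∎)
  where
  open ℚᵘ.≤-Reasoning
  cross : + (m ℕ.+ k) ℤ.* + 1 ≡ (+ m ℤ.* + 1 ℤ.+ + k ℤ.* + 1) ℤ.* + 1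
  cross rewrite ℤ.*-identityʳ (+ m) | ℤ.*-identityʳ (+ k) = refl

positive-numerator : ∀ ε → 0ℚ <ℚ ε → ∃[ a ] ℚ.↥ ε ≡ + suc a
positive-numerator ε@(ℚ.mkℚ i _ _) 0<ε = ℤ-positive i (ℚ.positive {ε} 0<ε)
  where
  ℤ-positive : ∀ i → ℤ.Positive i → ∃[ a ] i ≡ + suc a
  ℤ-positive (+ suc a) _ = a , refl

-- Absorbs the bounded rounding loss `k` of the blow-up into the term `q * r`.
[p-q]*r≤m : ∀ p q r m k → p * r ≤ℚ + (m ℕ.+ k) / 1 → + k / 1 ≤ℚ q * r → (p - q) * r ≤ℚ + m / 1
[p-q]*r≤m p q r m k pr≤m+k k≤qr = begin
  (p - q) * r                              ≡⟨ ℚ.*-distribʳ-+ r p (ℚ.- q) ⟩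
  p * r + (ℚ.- q) * r                      ≡⟨ cong (λ s → p * r + s) (ℚ.neg-distribˡ-* q r) ⟨
  p * r - q * r                            ≤⟨ ℚ.+-mono-≤ pr≤m+k (ℚ.neg-antimono-≤ k≤qr) ⟩
  + (m ℕ.+ k) / 1 - + k / 1                ≡⟨ cong (λ s → s - + k / 1) (/1-homo-+ m k) ⟩
  (+ m / 1 + + k / 1) - + k / 1            ≡⟨ ℚ.+-assoc (+ m / 1) (+ k / 1) _ ⟩
  + m / 1 + (+ k / 1 - + k / 1)            ≡⟨ cong (λ s → + m / 1 + s) (ℚ.+-inverseʳ (+ k / 1)) ⟩
  + m / 1 + 0ℚ                             ≡⟨ ℚ.+-identityʳ _ ⟩
  + m / 1                                  ∎
  where open ℚ.≤-Reasoning

theorem2p4 : ∀ (ε : ℚ) → 0ℚ <ℚ ε →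
    ∃ λ (N : ℕ) → ∀ (n : ℕ) → N ≤ n →
    (Σ (ThreeGraph n) λ H → (J₄ -free) H ×
    ((+ 4 / 7 - ε) * (+ n / 1) ≤ℚ + (δ₂⁺ H) / 1))
    × (∀ (H : ThreeGraph n) → (J₄ -free) H →
    + (δ₂⁺ H) / 1 ≤ℚ (+ 4 / 7 + ε) * (+ n / 1))
theorem2p4 ε 0<ε = N , λ n N≤n → (fanoBlowup n , fanoBlowup-J₄-free n , lower n N≤n) , upper n
  where
  N : ℕ
  -- The 3 provides an edge in the blow-up; the other term gives `ε` · n ≥ 4, as `ε` is at least the
  -- reciprocal of its denominator.
  N = 3 ℕ.+ 4 ℕ.* ℚ.↧ₙ ε

  lower : ∀ n → N ≤ n → (+ 4 / 7 - ε) * (+ n / 1) ≤ℚ + δ₂⁺ (fanoBlowup n) / 1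
  lower n N≤n = let a , ↥ε≡1+a = positive-numerator ε 0<ε in
    [p-q]*r≤m (+ 4 / 7) ε (+ n / 1) δ 4
      (p*n≤m (+ 4 / 7) 4 n (δ ℕ.+ 4) refl (begin
        4 ℕ.* n          ≤⟨ 4n≤7δ₂⁺-fanoBlowup n (ℕ.m+n≤o⇒m≤o 3 N≤n) ⟩
        -- Rounding 24 up to 28 = 7 · 4 turns the error into an additive 4 on `δ`.
        7 ℕ.* δ ℕ.+ 24   ≤⟨ ℕ.+-monoʳ-≤ (7 ℕ.* δ) (ℕ.≤ᵇ⇒≤ 24 28 _) ⟩
        7 ℕ.* δ ℕ.+ 28   ≡⟨ regroup δ ⟩
        (δ ℕ.+ 4) ℕ.* 7  ∎))
      (m≤p*n ε (suc a) n 4 ↥ε≡1+a (ℕ.≤-trans (ℕ.m+n≤o⇒n≤o 3 N≤n) (ℕ.m≤n*m n (suc a))))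
    where
    open ℕ.≤-Reasoning
    δ : ℕ
    δ = δ₂⁺ (fanoBlowup n)
    regroup : ∀ d → 7 ℕ.* d ℕ.+ 28 ≡ (d ℕ.+ 4) ℕ.* 7
    regroup = solve-∀

  upper : ∀ n (H : ThreeGraph n) → (J₄ -free) H → + δ₂⁺ H / 1 ≤ℚ (+ 4 / 7 + ε) * (+ n / 1)
  upper n H free = ℚ.≤-trans
    (m≤p*n (+ 4 / 7) 4 n (δ₂⁺ H) refl
      (subst (_≤ 4 ℕ.* n) (ℕ.*-comm 7 (δ₂⁺ H)) (UpperBound.7δ₂⁺≤4n H free)))
    (ℚ.*-monoʳ-≤-nonNeg (+ n / 1) {{ℚ.normalize-nonNeg n 1}}
      (ℚ.+-monoʳ-≤ (+ 4 / 7) (ℚ.<⇒≤ 0<ε)))
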